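{- Let $(g_i)_{i\in\mathbf{N}}$ be a sequence of integers such that $g_i\ge 2$ for all $i\in\mathbf{N}$, and let $\mathcal{G}$ be the British number system generated by $(g_i)_{i\in\mathbf{N}}$. Let $\mathcal{A}$ be an additive system, and for $n\in\mathbf{N}$ let $\mathcal{A}^{(n)}=(g_i)_{i\in[1,n]}\ast\mathcal{A}$ be the dilation of $\mathcal{A}$ by the finite sequence $(g_1,\ldots,g_n)$. Then \[ \lim_{n\rightarrow\infty}\mathcal{A}^{(n)}=\mathcal{G}. \]
   Context: $\mathbf{N}=\{1,2,3,\ldots\}$ and $\mathbf{N}_0=\{0,1,2,\ldots\}$. For integers $a<b$, $[a,b)=\{x\in\mathbf{Z}: a\le x<b\}$. For an integer $g$ and a set $X$ of integers, $g\ast X=\{gx:x\in X\}$. Additive system: a family $\mathcal{A}=(A_i)_{i\in I}$, indexed by a nonempty finite or infinite set $I$, of sets of nonnegative integers with $0\in A_i$ and $|A_i|\ge 2$ for all $i\in I$, such that every $n\in\mathbf{N}_0$ has a unique representation $n=\sum_{i\in I}a_i$ with $a_i\in A_i$ for all $i$ and $a_i\neq 0$ for only finitely many $i$. A set $S$ belongs to $\mathcal{A}$ if $S=A_i$ for some $i\in I$. British number system generated by $(g_i)_{i\in\mathbf{N}}$: put $G_0=1$ and $G_i=\prod_{j=1}^i g_j$; it is the additive system $(G_{i-1}\ast[0,g_i))_{i\in\mathbf{N}}$. Dilation: for an integer $g\ge2$ and an additive system $\mathcal{A}=(A_i)_{i\in I}$, the dilation $g\ast\mathcal{A}$ is the additive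 system consisting of the set $[0,g)$ (attached to a new index not in $I$) together with the sets $g\ast A_i$ for $i\in I$. The dilation by a finite sequence is defined inductively by $(g_i)_{i\in[1,1]}\ast\mathcal{A}=g_1\ast\mathcal{A}$ and $(g_i)_{i\in[1,n]}\ast\mathcal{A}=g_1\ast\left((g_i)_{i\in[2,n]}\ast\mathcal{A}\right)$; that is, $(g_i)_{i\in[1,n]}\ast\mathcal{A}=g_1\ast(g_2\ast(\cdots(g_n\ast\mathcal{A})\cdots))$. Limit: for a sequence $(\mathcal{A}^{(n)})_{n\in\mathbf{N}}$ of additive systems and an additive system $\mathcal{L}$, one writes $\lim_{n\to\infty}\mathcal{A}^{(n)}=\mathcal{L}$ if for every set $S$: $S$ belongs to $\mathcal{L}$ if and only if $S$ belongs to $\mathcal{A}^{(n)}$ for all sufficiently large $n$. -}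

module Defs where

open import Data.Empty using (⊥-elim)
open import Data.Fin.Base as Fin using (Fin)
open import Data.List.Base using (List; []; _∷_; map; sum; catMaybes)
open import Data.List.Membership.Propositional using (_∈_; _∉_)
open import Data.List.Membership.Propositional.Properties using (∈-map⁺)
open import Data.List.Properties using (map-∘; map-cong)
open import Data.List.Relation.Unary.All as All using (All; []; _∷_)
open import Data.List.Relation.Unary.All.Properties using (All¬⇒¬Any; ¬Any⇒All¬)
open import Data.List.Relation.Unary.AllPairs using ([]; _∷_)
open import Data.List.Relation.Unary.Any using (here; there)
open import Data.List.Relation.Unary.Unique.Propositional using (Unique)
open import Data.List.Relation.Unary.Unique.Propositional.Properties using (map⁺)
open import Data.Maybe.Base using (Maybe; nothing; just)
open import Data.Maybe.Properties using (just-injective)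
open import Data.Nat.Base
open import Data.Nat.DivMod
open import Data.Nat.Induction using (<-rec)
open import Data.Nat.Properties
open import Data.Product.Base using (Σ; ∃; ∃-syntax; ∃₂; _×_; _,_; proj₁; proj₂)
open import Function.Base using (_∘_)
open import Function.Bundles using (_⇔_)
open import Level using (0ℓ)
open import Relation.Binary.PropositionalEquality
open import Relation.Nullary using (yes; no)
open import Relation.Unary using (Pred; _≐_; _⊆_)

SetOfℕ : Set₁
SetOfℕ = Pred ℕ 0ℓ

[0,_⟩ : ℕ → SetOfℕ
[0, g ⟩ x = x < g

infixr 7 _∗_

_∗_ : ℕ → SetOfℕ → SetOfℕ
(g ∗ X) y = ∃[ x ] X x × y ≡ g * x

AtLeastTwo : SetOfℕ → Set
AtLeastTwo X = ∃₂ λ x y → X x × X y × x ≢ y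

-- n = Σᵢ aᵢ with aᵢ ∈ Aᵢ and all but finitely many aᵢ zero.  The sum is
-- taken over a duplicate-free list containing every i with aᵢ ≠ 0; its
-- value does not depend on the choice of that list.
record Representation {I : Set} (A : I → SetOfℕ) (n : ℕ) : Set where
  field
    term    : I → ℕ
    term∈   : ∀ i → A i (term i)
    support : List I
    unique  : Unique support
    covers  : ∀ i → term i ≢ 0 → i ∈ support
    total   : n ≡ sum (map term support)

open Representation

-- Representations are compared by their terms only, not by the lists
-- used to write down the sums.
record IsAdditiveSystem {I : Set} (A : I → SetOfℕ) : Set where
  field
    inhabited  : I
    zero∈      : ∀ i → A i 0
    atLeastTwo : ∀ i → AtLeastTwo (A i)
    represent  : ∀ n → Representation A n
    uniqueRep  : ∀ {n} (r s : Representation A n) → ∀ i → term r i ≡ term s i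

record AdditiveSystem : Set₁ where
  field
    Index            : Set
    sets             : Index → SetOfℕ
    isAdditiveSystem : IsAdditiveSystem sets

  open IsAdditiveSystem isAdditiveSystem public

infix 4 _BelongsTo_

_BelongsTo_ : SetOfℕ → AdditiveSystem → Set
S BelongsTo A = ∃[ i ] S ≐ AdditiveSystem.sets A i

Lim : (ℕ → AdditiveSystem) → AdditiveSystem → Set₁
Lim A L = ∀ (S : SetOfℕ) →
  S BelongsTo L ⇔ (∃[ N ] ∀ n → N ≤ n → S BelongsTo A n)

dilateSets : {I : Set} → ℕ → (I → SetOfℕ) → Maybe I → SetOfℕ
dilateSets g A nothing  = [0, g ⟩
dilateSets g A (just i) = g ∗ A i

-- Families indexed by the positive integers are indexed by ℕ from 0: g 0 is
-- the first term g₁, so G g i is Gᵢ = g₁ ⋯ gᵢ and britishSets g i is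
-- Gᵢ ∗ [0, gᵢ₊₁).
G : (ℕ → ℕ) → ℕ → ℕ
G g zero    = 1
G g (suc i) = G g i * g i

britishSets : (ℕ → ℕ) → ℕ → SetOfℕ
britishSets g i = G g i ∗ [0, g i ⟩

private
  module _ {I J : Set} {A : I → SetOfℕ} {B : J → SetOfℕ}
           (f : I → J) (f⁻ : J → I)
           (f∘f⁻ : ∀ j → f (f⁻ j) ≡ j) (f⁻∘f : ∀ i → f⁻ (f i) ≡ i)
           (A⊆B : ∀ j → A (f⁻ j) ⊆ B j) where

    reindex : ∀ {n} → Representation A n → Representation B n
    reindex r .term j = term r (f⁻ j)
    reindex r .term∈ j = A⊆B j (term∈ r (f⁻ j))
    reindex r .support = map f (support r)
    reindex r .unique = map⁺ f-injective (unique r)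
      where
      f-injective : ∀ {x y} → f x ≡ f y → x ≡ y
      f-injective {x} {y} eq = trans (sym (f⁻∘f x)) (trans (cong f⁻ eq) (f⁻∘f y))
    reindex r .covers j ≢0 =
      subst (_∈ map f (support r)) (f∘f⁻ j) (∈-map⁺ f (covers r (f⁻ j) ≢0))
    reindex r .total = trans (total r) (cong sum (trans
      (map-cong (λ i → cong (term r) (sym (f⁻∘f i))) (support r))
      (map-∘ (support r))))

  module _ {I : Set} where

    catMaybes-∈ : ∀ {i : I} xs → just i ∈ xs → i ∈ catMaybes xs
    catMaybes-∈ (just _ ∷ xs)  (here refl) = here refl
    catMaybes-∈ (just _ ∷ xs)  (there p)   = there (catMaybes-∈ xs p)
    catMaybes-∈ (nothing ∷ xs) (there p)   = catMaybes-∈ xs p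

    ∈-catMaybes : ∀ {i : I} xs → i ∈ catMaybes xs → just i ∈ xs
    ∈-catMaybes (just _ ∷ xs)  (here refl) = here refl
    ∈-catMaybes (just _ ∷ xs)  (there p)   = there (∈-catMaybes xs p)
    ∈-catMaybes (nothing ∷ xs) p           = there (∈-catMaybes xs p)

    catMaybes-unique : ∀ {xs : List (Maybe I)} → Unique xs → Unique (catMaybes xs)
    catMaybes-unique [] = []
    catMaybes-unique {just i ∷ xs} (i∉ ∷ u) =
      ¬Any⇒All¬ _ (λ i∈ → All¬⇒¬Any i∉ (∈-catMaybes xs i∈)) ∷ catMaybes-unique u
    catMaybes-unique {nothing ∷ xs} (_ ∷ u) = catMaybes-unique u

    module _ (g : ℕ) (t : Maybe I → ℕ) (t′ : I → ℕ)
             (t≡ : ∀ i → t (just i) ≡ g * t′ i) where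

      private
        ⟦_⟧ : List (Maybe I) → ℕ
        ⟦ xs ⟧ = g * sum (map t′ (catMaybes xs))

      sum-multiple : ∀ xs → nothing ∉ xs → sum (map t xs) ≡ ⟦ xs ⟧
      sum-multiple [] _ = sym (*-zeroʳ g)
      sum-multiple (nothing ∷ xs) ∉ = ⊥-elim (∉ (here refl))
      sum-multiple (just i ∷ xs) ∉ = trans
        (cong₂ _+_ (t≡ i) (sum-multiple xs (∉ ∘ there)))
        (sym (*-distribˡ-+ g (t′ i) _))

      sum-split : ∀ {xs} → Unique xs → (nothing ∉ xs → t nothing ≡ 0) →
                  sum (map t xs) ≡ t nothing + ⟦ xs ⟧
      sum-split {[]} _ h =
        sym (cong₂ _+_ (h (λ ())) (*-zeroʳ g))
      sum-split {nothing ∷ xs} (∉ ∷ _) _ =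
        cong (t nothing +_) (sum-multiple xs (All¬⇒¬Any ∉))
      sum-split {just i ∷ xs} (_ ∷ u) h = begin
        t (just i) + sum (map t xs)         ≡⟨ cong₂ _+_ (t≡ i) (sum-split u h′) ⟩
        g * t′ i + (t nothing + ⟦ xs ⟧)     ≡⟨ +-assoc (g * t′ i) _ _ ⟨
        g * t′ i + t nothing + ⟦ xs ⟧       ≡⟨ cong (_+ ⟦ xs ⟧) (+-comm (g * t′ i) _) ⟩
        t nothing + g * t′ i + ⟦ xs ⟧       ≡⟨ +-assoc (t nothing) _ _ ⟩
        t nothing + (g * t′ i + ⟦ xs ⟧)     ≡⟨ cong (t nothing +_) (*-distribˡ-+ g (t′ i) _) ⟨
        t nothing + ⟦ just i ∷ xs ⟧         ∎
        where
        open ≡-Reasoning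
        h′ : nothing ∉ xs → t nothing ≡ 0
        h′ ∉ = h λ { (there p) → ∉ p }

  divMod-unique : ∀ {g} → 2 ≤ g → ∀ {a b q p} → a < g → b < g →
                  a + g * q ≡ b + g * p → a ≡ b × q ≡ p
  divMod-unique {g@(suc _)} _ {a} {b} {q} {p} a<g b<g eq = a≡b , q≡p
    where
    mod : ∀ x y → x < g → (x + g * y) % g ≡ x
    mod x y x<g = trans (cong (λ z → (x + z) % g) (*-comm g y))
                        (trans ([m+kn]%n≡m%n x y g) (m<n⇒m%n≡m x<g))
    a≡b : a ≡ b
    a≡b = trans (sym (mod a q a<g)) (trans (cong (_% g) eq) (mod b p b<g))
    q≡p : q ≡ p
    q≡p = *-cancelˡ-≡ q p g (+-cancelˡ-≡ a _ _ (trans eq (cong (_+ g * p) (sym a≡b))))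

  divMod : ∀ {g} → 2 ≤ g → ∀ n → ∃₂ λ a q → a < g × n ≡ a + g * q × (n ≢ 0 → q < n)
  divMod {g@(suc _)} g≥2 n = n % g , n / g , m%n<n n g
    , trans (m≡m%n+[m/n]*n n g) (cong (n % g +_) (*-comm (n / g) g))
    , λ n≢0 → m/n<m n g {{≢-nonZero n≢0}} g≥2

  module _ {I : Set} {A : I → SetOfℕ} {g : ℕ} (g≥2 : 2 ≤ g) where

    quotient : ∀ {n} (r : Representation (dilateSets g A) n) →
      ∃[ q ] n ≡ term r nothing + g * q ×
        Σ (Representation A q) λ s → ∀ i → term r (just i) ≡ g * term s i
    quotient r = _
      , trans (total r) (sum-split g (term r) t′ t≡ (unique r) absent)
      , s , t≡
      where
      t′ : I → ℕ
      t′ i = proj₁ (term∈ r (just i))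
      t≡ : ∀ i → term r (just i) ≡ g * t′ i
      t≡ i = proj₂ (proj₂ (term∈ r (just i)))
      absent : nothing ∉ support r → term r nothing ≡ 0
      absent ∉ with term r nothing ≟ 0
      ... | yes ≡0 = ≡0
      ... | no  ≢0 = ⊥-elim (∉ (covers r nothing ≢0))
      s : Representation A _
      s .term = t′
      s .term∈ i = proj₁ (proj₂ (term∈ r (just i)))
      s .support = catMaybes (support r)
      s .unique = catMaybes-unique (unique r)
      s .covers i ≢0 = catMaybes-∈ (support r) (covers r (just i) λ ≡0 →
        ≢0 (m*n≡0⇒n≡0 (trans (sym (t≡ i)) ≡0)))
        where
        m*n≡0⇒n≡0 : ∀ {n} → g * n ≡ 0 → n ≡ 0
        m*n≡0⇒n≡0 {n} e = *-cancelˡ-≡ n 0 g {{>-nonZero (≤-trans (s≤s z≤n) g≥2)}}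
                            (trans e (sym (*-zeroʳ g)))
      s .total = refl

    quotient₂ : ∀ {n} (r r′ : Representation (dilateSets g A) n) →
      term r nothing ≡ term r′ nothing ×
      ∃[ q ] Σ (Representation A q) λ s → Σ (Representation A q) λ s′ →
        ∀ i → term s i ≡ term s′ i → term r (just i) ≡ term r′ (just i)
    quotient₂ r r′
      with q , eq , s , t ← quotient r | q′ , eq′ , s′ , t′ ← quotient r′
      with a≡b , refl ← divMod-unique g≥2 {q = q} {p = q′} (term∈ r nothing) (term∈ r′ nothing)
                          (trans (sym eq) eq′)
      = a≡b , q , s , s′ , λ i e → trans (t i) (trans (cong (g *_) e) (sym (t′ i)))

    combine : ∀ {a q} → a < g → Representation A q →
              Representation (dilateSets g A) (a + g * q)
    combine {a} {q} a<g s = r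
      where
      t : Maybe I → ℕ
      t nothing  = a
      t (just i) = g * term s i
      sum-scaled : ∀ xs → g * sum (map (term s) xs) ≡ sum (map t (map just xs))
      sum-scaled []       = *-zeroʳ g
      sum-scaled (x ∷ xs) = trans (*-distribˡ-+ g (term s x) _)
                                  (cong (g * term s x +_) (sum-scaled xs))
      nothing∉ : ∀ xs → All (nothing ≢_) (map just xs)
      nothing∉ []       = []
      nothing∉ (_ ∷ xs) = (λ ()) ∷ nothing∉ xs
      r : Representation (dilateSets g A) (a + g * q)
      r .term = t
      r .term∈ nothing  = a<g
      r .term∈ (just i) = term s i , term∈ s i , refl
      r .support = nothing ∷ map just (support s)
      r .unique = nothing∉ (support s) ∷ map⁺ just-injective (unique s)
      r .covers nothing  _  = here refl
      r .covers (just i) ≢0 = there (∈-map⁺ just (covers s i λ ≡0 →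
        ≢0 (trans (cong (g *_) ≡0) (*-zeroʳ g))))
      r .total = cong (a +_) (trans (cong (g *_) (total s)) (sum-scaled (support s)))

  [0,⟩-atLeastTwo : ∀ {g} → 2 ≤ g → AtLeastTwo [0, g ⟩
  [0,⟩-atLeastTwo g≥2 = 0 , 1 , ≤-trans (s≤s z≤n) g≥2 , g≥2 , λ ()

  ∗-atLeastTwo : ∀ {g X} → g ≢ 0 → AtLeastTwo X → AtLeastTwo (g ∗ X)
  ∗-atLeastTwo {g} g≢0 (x , y , x∈ , y∈ , x≢y) =
    g * x , g * y , (x , x∈ , refl) , (y , y∈ , refl) ,
    λ e → x≢y (*-cancelˡ-≡ x y g {{≢-nonZero g≢0}} e)

  ≥2⇒≢0 : ∀ {g} → 2 ≤ g → g ≢ 0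
  ≥2⇒≢0 () refl

module _ {I : Set} {A : I → SetOfℕ} {g : ℕ} (g≥2 : 2 ≤ g) (isA : IsAdditiveSystem A) where

  open IsAdditiveSystem

  dilate-isAdditiveSystem : IsAdditiveSystem (dilateSets g A)
  dilate-isAdditiveSystem .inhabited = nothing
  dilate-isAdditiveSystem .zero∈ nothing  = ≤-trans (s≤s z≤n) g≥2
  dilate-isAdditiveSystem .zero∈ (just i) = 0 , zero∈ isA i , sym (*-zeroʳ g)
  dilate-isAdditiveSystem .atLeastTwo nothing  = [0,⟩-atLeastTwo g≥2
  dilate-isAdditiveSystem .atLeastTwo (just i) = ∗-atLeastTwo (≥2⇒≢0 g≥2) (atLeastTwo isA i)
  dilate-isAdditiveSystem .represent n with _ , q , a<g , refl , _ ← divMod g≥2 n =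
    combine g≥2 a<g (represent isA q)
  dilate-isAdditiveSystem .uniqueRep r s nothing = proj₁ (quotient₂ g≥2 r s)
  dilate-isAdditiveSystem .uniqueRep r s (just i)
    with _ , _ , r′ , s′ , h ← quotient₂ g≥2 r s = h i (uniqueRep isA r′ s′ i)

private
  toMaybe : ℕ → Maybe ℕ
  toMaybe zero    = nothing
  toMaybe (suc i) = just i

  fromMaybe : Maybe ℕ → ℕ
  fromMaybe nothing  = zero
  fromMaybe (just i) = suc i

  to∘from : ∀ i → toMaybe (fromMaybe i) ≡ i
  to∘from nothing  = refl
  to∘from (just i) = refl

  from∘to : ∀ i → fromMaybe (toMaybe i) ≡ i
  from∘to zero    = refl
  from∘to (suc i) = refl

  G-suc : ∀ g i → G g (suc i) ≡ g 0 * G (g ∘ suc) i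
  G-suc g zero    = trans (+-identityʳ (g 0)) (sym (*-identityʳ (g 0)))
  G-suc g (suc i) = trans (cong (_* g (suc i)) (G-suc g i)) (*-assoc (g 0) _ _)

  G≢0 : ∀ {g} → (∀ i → 2 ≤ g i) → ∀ i → G g i ≢ 0
  G≢0 {g} g≥2 (suc i) e = ≥2⇒≢0 (g≥2 i)
    (*-cancelˡ-≡ (g i) 0 (G g i) {{≢-nonZero (G≢0 g≥2 i)}} (trans e (sym (*-zeroʳ (G g i)))))

  british⊆dilate : ∀ g i → britishSets g (fromMaybe i) ⊆ dilateSets (g 0) (britishSets (g ∘ suc)) i
  british⊆dilate g nothing  (x , x< , refl) = subst (_< g 0) (sym (*-identityˡ x)) x<
  british⊆dilate g (just i) (x , x< , refl) = G (g ∘ suc) i * x , (x , x< , refl) ,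
    trans (cong (_* x) (G-suc g i)) (*-assoc (g 0) _ x)

  dilate⊆british : ∀ g i → dilateSets (g 0) (britishSets (g ∘ suc)) (toMaybe i) ⊆ britishSets g i
  dilate⊆british g zero    {x} x< = x , x< , sym (*-identityˡ x)
  dilate⊆british g (suc i) (_ , (x , x< , refl) , refl) = x , x< ,
    trans (sym (*-assoc (g 0) _ x)) (cong (_* x) (sym (G-suc g i)))

  british-represent : ∀ n g → (∀ i → 2 ≤ g i) → Representation (britishSets g) n
  british-represent = <-rec _ λ n rec g g≥2 → step n rec g g≥2
    where
    step : ∀ n → (∀ {q} → q < n → ∀ g → (∀ i → 2 ≤ g i) → Representation (britishSets g) q) →
           ∀ g → (∀ i → 2 ≤ g i) → Representation (britishSets g) n
    step zero rec g g≥2 = record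
      { term    = λ _ → 0
      ; term∈   = λ i → 0 , ≤-trans (s≤s z≤n) (g≥2 i) , sym (*-zeroʳ (G g i))
      ; support = []
      ; unique  = []
      ; covers  = λ _ ≢0 → ⊥-elim (≢0 refl)
      ; total   = refl
      }
    step n@(suc _) rec g g≥2 with a , q , a<g , eq , q< ← divMod (g≥2 0) n =
      subst (Representation (britishSets g)) (sym eq)
        (reindex fromMaybe toMaybe from∘to to∘from (dilate⊆british g)
          (combine (g≥2 0) a<g (rec (q< λ ()) (g ∘ suc) (g≥2 ∘ suc))))

  british-uniqueRep : ∀ i g → (∀ i → 2 ≤ g i) → ∀ {n} (r s : Representation (britishSets g) n) →
                      term r i ≡ term s i
  british-uniqueRep i g g≥2 r s
    with quotient₂ (g≥2 0)
           (reindex toMaybe fromMaybe to∘from from∘to (british⊆dilate g) r)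
           (reindex toMaybe fromMaybe to∘from from∘to (british⊆dilate g) s)
  british-uniqueRep zero    g g≥2 r s | e , _ = e
  british-uniqueRep (suc i) g g≥2 r s | _ , _ , r′ , s′ , h =
    h i (british-uniqueRep i (g ∘ suc) (g≥2 ∘ suc) r′ s′)

module _ {g : ℕ → ℕ} (g≥2 : ∀ i → 2 ≤ g i) where

  open IsAdditiveSystem

  british-isAdditiveSystem : IsAdditiveSystem (britishSets g)
  british-isAdditiveSystem .inhabited = 0
  british-isAdditiveSystem .zero∈ i = 0 , ≤-trans (s≤s z≤n) (g≥2 i) , sym (*-zeroʳ (G g i))
  british-isAdditiveSystem .atLeastTwo i = ∗-atLeastTwo (G≢0 g≥2 i) ([0,⟩-atLeastTwo (g≥2 i))
  british-isAdditiveSystem .represent n = british-represent n g g≥2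
  british-isAdditiveSystem .uniqueRep r s i = british-uniqueRep i g g≥2 r s

british : (g : ℕ → ℕ) → (∀ i → 2 ≤ g i) → AdditiveSystem
british g g≥2 = record { isAdditiveSystem = british-isAdditiveSystem g≥2 }

dilate : (g : ℕ) → 2 ≤ g → AdditiveSystem → AdditiveSystem
dilate g g≥2 A = record
  { isAdditiveSystem = dilate-isAdditiveSystem g≥2 (AdditiveSystem.isAdditiveSystem A) }

dilateSeq : ∀ {n} (g : Fin (suc n) → ℕ) → (∀ i → 2 ≤ g i) → AdditiveSystem → AdditiveSystem
dilateSeq {zero}  g g≥2 A = dilate (g Fin.zero) (g≥2 Fin.zero) A
dilateSeq {suc n} g g≥2 A =
  dilate (g Fin.zero) (g≥2 Fin.zero) (dilateSeq (g ∘ Fin.suc) (g≥2 ∘ Fin.suc) A)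

{-# OPTIONS --safe #-}
-- For m ≤ n the set G_{m-1} ∗ [0, g_m) belongs to 𝒜⁽ⁿ⁾; the other sets of
-- 𝒜⁽ⁿ⁾ consist of multiples of G_n.  Since G_n → ∞, a set with a nonzero
-- element s cannot be of the latter kind once G_n > s.

module Submission where

open import Defs
open import Data.Nat.Base using (ℕ; _≤_; zero; suc; _*_; _<_; _⊔_; z≤n; s≤s; ≢-nonZero; >-nonZero)
open import Data.Fin.Base using (toℕ)
open import Data.Maybe.Base using (just; nothing)
open import Data.Nat.Divisibility using (_∣_; ∣⇒≤; *-monoʳ-∣; m∣m*n)
open import Data.Nat.Properties
open import Data.Product.Base using (∃-syntax; _×_; _,_)
open import Data.Sum.Base using (_⊎_; inj₁; inj₂)
open import Function.Base using (_∘_)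
open import Function.Bundles using (mk⇔)
open import Relation.Binary.PropositionalEquality
open import Relation.Nullary using (yes; no; contradiction)
open import Relation.Unary using (_≐_; _⊆_)
open import Relation.Unary.Properties using (≐-sym; ≐-trans)

open AdditiveSystem using (Index; sets; atLeastTwo)

∗-mono : ∀ g {X Y : SetOfℕ} → X ⊆ Y → (g ∗ X) ⊆ (g ∗ Y)
∗-mono g X⊆Y (x , x∈X , eq) = x , X⊆Y x∈X , eq

∗-cong : ∀ g {X Y : SetOfℕ} → X ≐ Y → (g ∗ X) ≐ (g ∗ Y)
∗-cong g (X⊆Y , Y⊆X) = ∗-mono g X⊆Y , ∗-mono g Y⊆X

G-suc : ∀ g i → G g (suc i) ≡ g 0 * G (g ∘ suc) i
G-suc g zero    = *-comm 1 (g 0)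
G-suc g (suc i) = trans (cong (_* g (suc i)) (G-suc g i)) (*-assoc (g 0) _ _)

-- Each factor is at least 2, so the positive product strictly grows at every step.
n<G : ∀ {g} → (∀ i → 2 ≤ g i) → ∀ n → n < G g n
n<G g≥2 zero = s≤s z≤n
n<G {g} g≥2 (suc n) = ≤-<-trans n<Gₙ
  (m<m*n (G g n) (g n) {{>-nonZero (≤-<-trans z≤n n<Gₙ)}} (g≥2 n))
  where
  n<Gₙ : n < G g n
  n<Gₙ = n<G g≥2 n

britishSets-zero : ∀ g → britishSets g 0 ≐ [0, g 0 ⟩
britishSets-zero g =
  (λ { (x , x<g , refl) → subst (_< g 0) (sym (*-identityˡ x)) x<g }) ,
  (λ {x} x<g → x , x<g , sym (*-identityˡ x))

-- Peels off the outermost generator, as the recursion of `dilateSeq` does; both inductions below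
-- follow the shift to `g ∘ suc`.
britishSets-suc : ∀ g i → britishSets g (suc i) ≐ g 0 ∗ britishSets (g ∘ suc) i
britishSets-suc g i =
  (λ { (x , x<g , refl) → _ , (x , x<g , refl) , assoc x }) ,
  (λ { (_ , (x , x<g , refl) , refl) → x , x<g , sym (assoc x) })
  where
  assoc : ∀ x → G g (suc i) * x ≡ g 0 * (G (g ∘ suc) i * x)
  assoc x = trans (cong (_* x) (G-suc g i)) (*-assoc (g 0) _ x)

nonzeroElement : ∀ {X} → AtLeastTwo X → ∃[ x ] X x × x ≢ 0
nonzeroElement (x , y , x∈X , y∈X , x≢y) with x ≟ 0
... | yes refl = y , y∈X , x≢y ∘ sym
... | no  x≢0  = x , x∈X , x≢0

module _ (A : AdditiveSystem) where

  -- Counting from 0, stage `n` uses the n + 1 generators `g 0`, ..., `g n`. Stage `suc n` unfolds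
  -- by computation to the dilation by `g 0` of stage `n` for `g ∘ suc`.
  dilations : (g : ℕ → ℕ) → (∀ i → 2 ≤ g i) → ℕ → AdditiveSystem
  dilations g g≥2 n = dilateSeq {n} (λ i → g (toℕ i)) (λ i → g≥2 (toℕ i)) A

  -- The interval contributed by `g m` is scaled only by the generators outside it, whose product is
  -- `G g m`; what lies deeper does not affect it.
  britishSets-belongsTo-dilations : ∀ g g≥2 {m n} → m ≤ n →
    britishSets g m BelongsTo dilations g g≥2 n
  britishSets-belongsTo-dilations g g≥2 {n = zero}  z≤n = nothing , britishSets-zero g
  britishSets-belongsTo-dilations g g≥2 {n = suc n} z≤n = nothing , britishSets-zero g
  britishSets-belongsTo-dilations g g≥2 {suc m} {suc n} (s≤s m≤n)
    with j , eq ← britishSets-belongsTo-dilations (g ∘ suc) (g≥2 ∘ suc) m≤n =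
    just j , ≐-trans (britishSets-suc g m) (∗-cong (g 0) eq)

  -- Peeling `just` from an index either meets `nothing`, the interval of some generator, or passes
  -- all n + 1 dilations and reaches a set of `A`, which has then been scaled by every generator.
  british-or-multiples : ∀ g g≥2 n (j : Index (dilations g g≥2 n)) →
    sets (dilations g g≥2 n) j BelongsTo british g g≥2 ⊎
    sets (dilations g g≥2 n) j ⊆ (G g (suc n) ∣_)
  british-or-multiples g g≥2 zero    nothing  = inj₁ (0 , ≐-sym (britishSets-zero g))
  british-or-multiples g g≥2 (suc n) nothing  = inj₁ (0 , ≐-sym (britishSets-zero g))
  british-or-multiples g g≥2 zero    (just j) = inj₂ λ { (x , _ , refl) →
    subst (_∣ g 0 * x) (sym (*-identityˡ (g 0))) (m∣m*n x) }
  british-or-multiples g g≥2 (suc n) (just j)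
    with british-or-multiples (g ∘ suc) (g≥2 ∘ suc) n j
  ... | inj₁ (m , eq) = inj₁ (suc m ,
    ≐-trans (∗-cong (g 0) eq) (≐-sym (britishSets-suc g m)))
  ... | inj₂ multiples = inj₂ λ { (x , x∈ , refl) →
    subst (_∣ g 0 * x) (sym (G-suc g (suc n))) (*-monoʳ-∣ (g 0) (multiples x∈)) }

  eventually⇒british : ∀ g g≥2 (S : SetOfℕ) →
    (∃[ N ] ∀ n → N ≤ n → S BelongsTo dilations g g≥2 n) → S BelongsTo british g g≥2
  eventually⇒british g g≥2 S (N , S∈)
    with i , _ , Aᵢ⊆S ← S∈ N ≤-refl
    -- `S` is an arbitrary predicate; its nonzero element comes from the set it equals at stage `N`.
    with s , s∈Aᵢ , s≢0 ← nonzeroElement (atLeastTwo (dilations g g≥2 N) i)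
    -- At least `N`, so that `S` still belongs; at least `s`, so that the product of the generators
    -- exceeds `s`.
    with j , S≐Aⱼ@(S⊆Aⱼ , _) ← S∈ (N ⊔ s) (m≤m⊔n N s)
    with british-or-multiples g g≥2 (N ⊔ s) j
  ... | inj₁ (m , eq) = m , ≐-trans S≐Aⱼ eq
  -- Divisibility of the nonzero `s` would bound the product by `s`, yet `s` ≤ `suc (N ⊔ s)` <
  -- `G g (suc (N ⊔ s))`.
  ... | inj₂ multiples = contradiction
    (∣⇒≤ {{≢-nonZero s≢0}} (multiples (S⊆Aⱼ (Aᵢ⊆S s∈Aᵢ))))
    (<⇒≱ (≤-<-trans (m≤n⇒m≤1+n (m≤n⊔m N s)) (n<G g≥2 (suc (N ⊔ s)))))

theorem6 : (g : ℕ → ℕ) (g≥2 : ∀ i → 2 ≤ g i) (A : AdditiveSystem) →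
    Lim (λ n → dilateSeq {n} (λ i → g (toℕ i)) (λ i → g≥2 (toℕ i)) A) (british g g≥2)
theorem6 g g≥2 A S = mk⇔
  (λ { (m , S≐) → m , λ n m≤n →
    let j , eq = britishSets-belongsTo-dilations A g g≥2 m≤n in j , ≐-trans S≐ eq })
  (eventually⇒british A g g≥2 S)
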